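{- Let $\alpha_i\ge 0$, $\beta_i>0$ ($1\le i\le 5$) be real numbers. For the network configuration $N/N^+$ with these parameters and total flow $Q>0$, the pseudo-paradox occurs if any one of the following conditions holds: (a) $0<Q\le\min\{ -\alpha/\beta_{45},\,-\bar\alpha/\beta_4\}$; (b) $0<Q\le\min\{\alpha/\beta_{12},\,-\hat\alpha/\beta_2\}$; (c) $Q>\max\{\alpha/\beta_{12},\,-\alpha/\beta_{45}\}$ and $Q\mathcal B_1\ge\hat\alpha\beta_{14}+\bar\alpha\beta_{25}$; (d) $\mathcal B_1=0$, $\hat\alpha\beta_{14}+\bar\alpha\beta_{25}>0$ and $Q>\max\{\alpha/\beta_{12},\,-\alpha/\beta_{45},\,\mu_1,\,\mu_2\}$.
   Context: The network $N^+$ has nodes $a,b,c,d$ and directed links $(a,b),(b,d),(b,c),(a,c),(c,d)$ with travel times $\alpha_1+\beta_1f_{ab}$, $\alpha_2+\beta_2f_{bd}$, $\alpha_3+\beta_3f_{bc}$, $\alpha_4+\beta_4f_{ac}$, $\alpha_5+\beta_5f_{cd}$ respectively, where $f_{ij}\ge 0$ is the (real) flow on link $(i,j)$ and $\alpha_i\ge 0$, $\beta_i>0$. All traffic, of total amount $Q>0$ (real), goes from $a$ to $d$ along the paths $P_1=a-b-d$, $P_2=a-c-d$, $P_3=a-b-c-d$. The network $N$ is $N^+$ with the link $(b,c)$ removed, so its paths are $P_1,P_2$ only. A flow assigns a non-negative real amount to each path, with total $Q$; the flow on a link is the sum of the flows of the paths containing it; the travel time on a path is the sum of the travel times of its links.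 A path has vanishing flow if its path flow is $0$. A network is at equilibrium if all paths with non-vanishing flow have the same travel time, and every path with vanishing flow has travel time at least this common value. The equilibrium exists and is unique; its common travel time is denoted $T_{Eq}$ for $N$ and $T^+_{Eq}$ for $N^+$ (both are functions of $Q$). The pseudo-paradox is said to occur in $N/N^+$ if $T^+_{Eq}=T_{Eq}$ for an interval of values of $Q$ (as opposed to a single point); it occurs for a given $Q$ if $Q$ belongs to such a non-degenerate interval. Notation: $\alpha_{ij}=\alpha_i+\alpha_j$, $\beta_{ij}=\beta_i+\beta_j$, $\alpha=\alpha_{45}-\alpha_{12}$, $\bar\alpha=\alpha_4-\alpha_{13}$, $\hat\alpha=\alpha_2-\alpha_{35}$, $\mathcal B_1=\beta_1\beta_5-\beta_2\beta_4$, and $$\mu_1=\frac{\hat\alpha\beta_{14}-\alpha\beta_3}{\beta_3\beta_{45}+\beta_5\beta_{14}},\qquad \mu_2=\frac{\bar\alpha\beta_{25}+\alpha\beta_3}{\beta_1\beta_{25}+\beta_3\beta_{12}}.$$ -}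

module Defs where

open import Algebra.Bundles using (CommutativeRing)
import Algebra.Construct.NaturalChoice.Max as Max
import Algebra.Construct.NaturalChoice.Min as Min
import Algebra.Definitions.RawMonoid as RawMonoid
open import Data.Bool.Base using (if_then_else_)
open import Data.Fin.Base using (Fin)
open import Data.Fin.Patterns using (0F; 1F; 2F; 3F; 4F)
import Data.Fin.Properties as Fin
open import Data.List.Base using (List; []; _∷_; filter; foldr; length; lookup)
open import Data.List.Membership.DecPropositional (Fin._≟_ {5}) using (_∈?_)
open import Data.Product.Base using (_×_; ∃; ∃₂)
open import Data.Vec.Functional using (Vector)
open import Level using (0ℓ; suc)
open import Relation.Binary.Bundles using (DecTotalOrder)
import Relation.Binary.Construct.NonStrictToStrict as ToStrict
open import Relation.Binary.Core using (Rel)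
open import Relation.Binary.Structures using (IsDecTotalOrder)
open import Relation.Nullary.Decidable.Core using (¬?; does)
open import Relation.Nullary.Negation.Core using (¬_)
open import Relation.Unary using (Pred)

-- The standard library has no real numbers.  They are axiomatised here in the
-- usual classical way, as a Dedekind-complete ordered field, which determines
-- them up to isomorphism.
record RealNumbers : Set (suc 0ℓ) where
  infix  4 _≤_
  infix  9 _⁻¹
  infixl 7 _/_

  field
    commutativeRing : CommutativeRing 0ℓ 0ℓ

  open CommutativeRing commutativeRing public

  field
    0≉1             : ¬ (0# ≈ 1#)
    _⁻¹             : Carrier → Carrier  -- the value at 0# is unspecified
    ⁻¹-inverseʳ     : ∀ {x} → ¬ (x ≈ 0#) → x * x ⁻¹ ≈ 1#
    _≤_             : Rel Carrier 0ℓ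
    isDecTotalOrder : IsDecTotalOrder _≈_ _≤_
    +-monoˡ-≤       : ∀ {x y} z → x ≤ y → x + z ≤ y + z
    *-nonNeg        : ∀ {x y} → 0# ≤ x → 0# ≤ y → 0# ≤ x * y

  IsUpperBound : Pred Carrier 0ℓ → Pred Carrier 0ℓ
  IsUpperBound P u = ∀ x → P x → x ≤ u

  field
    complete : (P : Pred Carrier 0ℓ) → ∃ P → ∃ (IsUpperBound P) →
               ∃ λ s → IsUpperBound P s × (∀ u → IsUpperBound P u → s ≤ u)

  decTotalOrder : DecTotalOrder 0ℓ 0ℓ 0ℓ
  decTotalOrder = record { isDecTotalOrder = isDecTotalOrder }

  open ToStrict _≈_ _≤_ public using (_<_)
  open Min (DecTotalOrder.totalOrder decTotalOrder) public using (_⊓_)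
  open Max (DecTotalOrder.totalOrder decTotalOrder) public using (_⊔_)

  _/_ : Carrier → Carrier → Carrier
  x / y = x * y ⁻¹

-- Links are numbered so that link i (counted from 1) carries α_i and β_i.
Link : Set
Link = Fin 5

pattern ab = 0F
pattern bd = 1F
pattern bc = 2F
pattern ac = 3F
pattern cd = 4F

Path : Set
Path = List Link

P₁ P₂ P₃ : Path
P₁ = ab ∷ bd ∷ []
P₂ = ac ∷ cd ∷ []
P₃ = ab ∷ bc ∷ cd ∷ []

-- A network is given by its paths from a to d.
Network : Set
Network = List Path

N⁺ N : Network
N⁺ = P₁ ∷ P₂ ∷ P₃ ∷ []
N  = filter (λ P → ¬? (bc ∈? P)) N⁺

module Traffic (ℝ : RealNumbers) (α β : Link → RealNumbers.Carrier ℝ) where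
  open RealNumbers ℝ
  open RawMonoid +-rawMonoid using (sum)

  PathFlow : Network → Set
  PathFlow G = Vector Carrier (length G)

  module _ (G : Network) where

    linkFlow : PathFlow G → Link → Carrier
    linkFlow f l = sum λ i → if does (l ∈? lookup G i) then f i else 0#

    linkTime : PathFlow G → Link → Carrier
    linkTime f l = α l + β l * linkFlow f l

    pathTime : PathFlow G → Fin (length G) → Carrier
    pathTime f i = foldr (λ l t → linkTime f l + t) 0# (lookup G i)

    IsFlow : Carrier → PathFlow G → Set
    IsFlow Q f = (∀ i → 0# ≤ f i) × sum f ≈ Q

    record IsEquilibrium (Q : Carrier) (f : PathFlow G) (T : Carrier) : Set where
      field
        isFlow       : IsFlow Q f
        nonVanishing : ∀ i → ¬ (f i ≈ 0#) → pathTime f i ≈ T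
        vanishing    : ∀ i → f i ≈ 0# → T ≤ pathTime f i

    -- T is the equilibrium travel time T_Eq(Q): it is attained at an
    -- equilibrium, and every equilibrium has common travel time T.
    record IsEquilibriumTime (Q T : Carrier) : Set where
      field
        attained : ∃ λ f → IsEquilibrium Q f T
        unique   : ∀ f T′ → IsEquilibrium Q f T′ → T′ ≈ T

  SameEquilibriumTime : Pred Carrier 0ℓ
  SameEquilibriumTime Q = ∃₂ λ T T⁺ →
    IsEquilibriumTime N Q T × IsEquilibriumTime N⁺ Q T⁺ × T⁺ ≈ T

  -- Any kind of interval is allowed: open, closed, half-open, unbounded.
  record IsNonDegenerateInterval (I : Pred Carrier 0ℓ) : Set where
    field
      convex        : ∀ {x y z} → I x → I z → x ≤ y → y ≤ z → I y
      nonDegenerate : ∃₂ λ x y → I x × I y × x < y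

  PseudoParadoxAt : Carrier → Set₁
  PseudoParadoxAt Q = ∃ λ (I : Pred Carrier 0ℓ) →
    IsNonDegenerateInterval I × I Q ×
    (∀ q → I q → 0# < q × SameEquilibriumTime q)

  α₁ α₂ α₃ α₄ α₅ β₁ β₂ β₃ β₄ β₅ : Carrier
  α₁ = α ab ; α₂ = α bd ; α₃ = α bc ; α₄ = α ac ; α₅ = α cd
  β₁ = β ab ; β₂ = β bd ; β₃ = β bc ; β₄ = β ac ; β₅ = β cd

  β₁₂ β₁₄ β₂₅ β₄₅ : Carrier
  β₁₂ = β₁ + β₂
  β₁₄ = β₁ + β₄
  β₂₅ = β₂ + β₅
  β₄₅ = β₄ + β₅

  -- α₀ is the unsubscripted α = α_45 - α_12 of the paper.
  α₀ ᾱ α̂ 𝓑₁ μ₁ μ₂ : Carrier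
  α₀ = (α₄ + α₅) - (α₁ + α₂)
  ᾱ  = α₄ - (α₁ + α₃)
  α̂  = α₂ - (α₃ + α₅)
  𝓑₁ = β₁ * β₅ - β₂ * β₄
  μ₁ = (α̂ * β₁₄ - α₀ * β₃) / (β₃ * β₄₅ + β₅ * β₁₄)
  μ₂ = (ᾱ * β₂₅ + α₀ * β₃) / (β₁ * β₂₅ + β₃ * β₁₂)

{-# OPTIONS --safe #-}
module Submission where

-- Uniqueness of the equilibrium time: if f, g are equilibria with times T, T′ and
-- ⟨f,g⟩ denotes Σ_P time_P(f) g_P, then ⟨f,f⟩ = TQ ≤ ⟨f,g⟩ and ⟨g,g⟩ = T′Q ≤ ⟨g,f⟩.
-- Rewriting ⟨f,g⟩ as a sum over links gives
-- ⟨f,f⟩ + ⟨g,g⟩ - ⟨f,g⟩ - ⟨g,f⟩ = Σ_l β_l (f_l - g_l)², so the link flows agree, hence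
-- ⟨f,g⟩ = ⟨g,g⟩ and T ≤ T′; by symmetry T = T′.
--
-- It then suffices to exhibit equilibria.  Under (a), (b) and (c) the equilibrium of N,
-- extended by zero flow on P₃, remains one in N⁺: all flow is on P₂, resp. P₁, resp.
-- split between them, and the last condition says that P₃ is not faster.  Under (d) all
-- three paths of N⁺ are used, and the common time does not change because 𝓑₁ = 0.
-- Each condition, read as a predicate of Q, is itself a non-degenerate interval.

open import Algebra.Bundles using (CommutativeRing; RawRing)
import Algebra.Construct.NaturalChoice.Max as Max
import Algebra.Construct.NaturalChoice.Min as Min
import Algebra.Properties.AbelianGroup as AbelianGroupProperties
import Algebra.Properties.CommutativeSemigroup as CommutativeSemigroupProperties
import Algebra.Properties.Group as GroupProperties
import Algebra.Properties.Ring as RingProperties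
import Algebra.Properties.Semiring.Mult.TCOptimised as Mult
import Algebra.Properties.Semiring.Sum as Sum
import Algebra.Solver.Ring as RingSolver
open import Algebra.Solver.Ring.AlmostCommutativeRing
  using (_-Raw-AlmostCommutative⟶_; Induced-equivalence; fromCommutativeRing)
import Algebra.Solver.Ring.NaturalCoefficients.Default as NaturalCoefficients
open import Data.Fin.Base using (suc)
open import Data.Fin.Patterns using (0F; 1F; 2F)
open import Data.Maybe.Base using (just; nothing)
open import Data.Nat.Base as ℕ using (ℕ)
import Data.Nat.Properties as ℕ
open import Data.Product.Base using (_×_; _,_; proj₁; proj₂; ∃; ∃₂)
open import Data.Sum.Base using (_⊎_; inj₁; inj₂)
open import Data.Vec.Functional using (Vector; []; _∷_)
open import Defs
open import Function.Base using (_∘_)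
open import Relation.Binary.Bundles using (DecTotalOrder)
import Relation.Binary.Construct.NonStrictToStrict as ToStrict
open import Relation.Binary.Definitions using (WeaklyDecidable)
import Relation.Binary.PropositionalEquality.Core as ≡
import Relation.Binary.Reasoning.Setoid as SetoidReasoning
open import Relation.Binary.Structures using (IsDecTotalOrder)
open import Relation.Nullary.Decidable.Core using (yes; no)
open import Relation.Nullary.Negation.Core using (¬_; contradiction)

-- A ring solver with integer coefficients, so that like terms cancel.  The
-- pair (m , n) stands for the integer m - n; the solver compares coefficients
-- syntactically, hence the reduction to m = 0 or n = 0.
module IntegerCoefficients {c ℓ} (R : CommutativeRing c ℓ) where
  open CommutativeRing R
  open Mult semiring using (×-homo-+; ×1-homo-*) renaming (_×_ to _·_)
  open AbelianGroupProperties +-abelianGroup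
    using (⁻¹-∙-comm; ⁻¹-anti-homo‿-)
  open CommutativeSemigroupProperties +-commutativeSemigroup using (interchange)
  open GroupProperties +-group using (ε⁻¹≈ε) renaming (⁻¹-involutive to -‿involutive)
  open RingProperties ring using (-‿distribˡ-*; -‿distribʳ-*)
  open SetoidReasoning setoid

  private
    almost = fromCommutativeRing R

    open NaturalCoefficients commutativeSemiring using (solve; _:=_; _:+_; _:*_)

    reduce : ℕ × ℕ → ℕ × ℕ
    reduce (m , n) = m ℕ.∸ n , n ℕ.∸ m

    _⊕_ _⊛_ : ℕ × ℕ → ℕ × ℕ → ℕ × ℕ
    (a , b) ⊕ (c , d) = reduce (a ℕ.+ c , b ℕ.+ d)
    (a , b) ⊛ (c , d) = reduce (a ℕ.* c ℕ.+ b ℕ.* d , a ℕ.* d ℕ.+ b ℕ.* c)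

    ⊝_ : ℕ × ℕ → ℕ × ℕ
    ⊝ (a , b) = b , a

    ℤ-ring : RawRing _ _
    ℤ-ring = record
      { Carrier = ℕ × ℕ
      ; _≈_     = ≡._≡_
      ; _+_     = _⊕_
      ; _*_     = _⊛_
      ; -_      = ⊝_
      ; 0#      = 0 , 0
      ; 1#      = 1 , 0
      }

    -- Splitting on the second component makes `0 , 0` and `1 , 0` evaluate definitionally to `0#`
    -- and `1#`, so `0-homo` and `1-homo` are `refl` and the constants `:0` and `:1` match the
    -- literals in goals.
    ⟦_⟧ : ℕ × ℕ → Carrier
    ⟦ m , ℕ.zero  ⟧ = m · 1#
    ⟦ m , ℕ.suc n ⟧ = m · 1# - ℕ.suc n · 1#

    ⟦⟧-difference : ∀ m n → ⟦ m , n ⟧ ≈ m · 1# - n · 1#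
    ⟦⟧-difference m (ℕ.suc n) = refl
    ⟦⟧-difference m ℕ.zero    = sym (trans (+-congˡ ε⁻¹≈ε) (+-identityʳ (m · 1#)))

    cancel : ∀ z {x y} → x - y ≈ (x + z) - (y + z)
    cancel z {x} {y} = begin
      x - y                ≈⟨ +-identityʳ _ ⟨
      (x - y) + 0#         ≈⟨ +-congˡ (-‿inverseʳ z) ⟨
      (x - y) + (z - z)    ≈⟨ interchange x (- y) z (- z) ⟩
      (x + z) + (- y - z)  ≈⟨ +-congˡ (⁻¹-∙-comm y z) ⟩
      (x + z) - (y + z)    ∎

    -- Each difference is padded by the second component of the other pair. Both then subtract the
    -- same amount, and the hypothesis in ℕ identifies what it is subtracted from.
    ⟦⟧-cong : ∀ a b c d → a ℕ.+ d ≡.≡ c ℕ.+ b → ⟦ a , b ⟧ ≈ ⟦ c , d ⟧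
    ⟦⟧-cong a b c d eq = begin
      ⟦ a , b ⟧                              ≈⟨ ⟦⟧-difference a b ⟩
      a · 1# - b · 1#                        ≈⟨ cancel (d · 1#) ⟩
      (a · 1# + d · 1#) - (b · 1# + d · 1#)  ≈⟨ +-cong (×-homo-+ 1# a d) (-‿cong (+-comm _ _)) ⟨
      (a ℕ.+ d) · 1# - (d · 1# + b · 1#)     ≡⟨ ≡.cong (λ n → n · 1# - (d · 1# + b · 1#)) eq ⟩
      (c ℕ.+ b) · 1# - (d · 1# + b · 1#)     ≈⟨ +-congʳ (×-homo-+ 1# c b) ⟩
      (c · 1# + b · 1#) - (d · 1# + b · 1#)  ≈⟨ cancel (b · 1#) ⟨
      c · 1# - d · 1#                        ≈⟨ ⟦⟧-difference c d ⟨
      ⟦ c , d ⟧                              ∎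

    ⟦⟧-reduce : ∀ m n → ⟦ reduce (m , n) ⟧ ≈ m · 1# - n · 1#
    ⟦⟧-reduce m n = trans (⟦⟧-cong (m ℕ.∸ n) (n ℕ.∸ m) m n (eq m n)) (⟦⟧-difference m n)
      where
      -- Both sides are the maximum of `m` and `n`.
      eq : ∀ m n → m ℕ.∸ n ℕ.+ n ≡.≡ m ℕ.+ (n ℕ.∸ m)
      eq ℕ.zero    n         = ≡.cong (ℕ._+ n) (ℕ.0∸n≡0 n)
      eq (ℕ.suc m) ℕ.zero    = ≡.refl
      eq (ℕ.suc m) (ℕ.suc n) = ≡.trans (ℕ.+-suc (m ℕ.∸ n) n) (≡.cong ℕ.suc (eq m n))

    +-homo : ∀ p q → ⟦ p ⊕ q ⟧ ≈ ⟦ p ⟧ + ⟦ q ⟧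
    +-homo (a , b) (c , d) = begin
      ⟦ (a , b) ⊕ (c , d) ⟧                      ≈⟨ ⟦⟧-reduce (a ℕ.+ c) (b ℕ.+ d) ⟩
      (a ℕ.+ c) · 1# - (b ℕ.+ d) · 1#            ≈⟨ +-cong (×-homo-+ 1# a c) (-‿cong (×-homo-+ 1# b d)) ⟩
      (a · 1# + c · 1#) - (b · 1# + d · 1#)      ≈⟨ +-congˡ (⁻¹-∙-comm _ _) ⟨
      (a · 1# + c · 1#) + (- (b · 1#) - d · 1#)  ≈⟨ interchange _ _ _ _ ⟩
      (a · 1# - b · 1#) + (c · 1# - d · 1#)      ≈⟨ +-cong (⟦⟧-difference a b) (⟦⟧-difference c d) ⟨
      ⟦ a , b ⟧ + ⟦ c , d ⟧                      ∎

    -x*-y≈x*y : ∀ x y → (- x) * (- y) ≈ x * y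
    -x*-y≈x*y x y = begin
      (- x) * (- y)  ≈⟨ -‿distribˡ-* x (- y) ⟨
      - (x * - y)    ≈⟨ -‿cong (-‿distribʳ-* x y) ⟨
      - - (x * y)    ≈⟨ -‿involutive _ ⟩
      x * y          ∎

    ·-homo : ∀ a b c d →
      (a ℕ.* b ℕ.+ c ℕ.* d) · 1# ≈ (a · 1#) * (b · 1#) + (c · 1#) * (d · 1#)
    ·-homo a b c d = trans (×-homo-+ 1# (a ℕ.* b) (c ℕ.* d))
                           (+-cong (×1-homo-* a b) (×1-homo-* c d))

    *-homo : ∀ p q → ⟦ p ⊛ q ⟧ ≈ ⟦ p ⟧ * ⟦ q ⟧
    *-homo (a , b) (c , d) = begin
      ⟦ (a , b) ⊛ (c , d) ⟧
        ≈⟨ ⟦⟧-reduce (a ℕ.* c ℕ.+ b ℕ.* d) (a ℕ.* d ℕ.+ b ℕ.* c) ⟩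
      (a ℕ.* c ℕ.+ b ℕ.* d) · 1# - (a ℕ.* d ℕ.+ b ℕ.* c) · 1#
        ≈⟨ +-cong (·-homo a c b d) (-‿cong (·-homo a d b c)) ⟩
      (x * z + y * w) - (x * w + y * z)
        ≈⟨ +-cong (+-congˡ (-x*-y≈x*y y w))
             (trans (+-cong (sym (-‿distribʳ-* x w)) (sym (-‿distribˡ-* y z))) (⁻¹-∙-comm _ _)) ⟨
      (x * z + (- y) * (- w)) + (x * (- w) + (- y) * z)
        ≈⟨ solve 4 (λ x y z w → (x :* z :+ y :* w) :+ (x :* w :+ y :* z) :=
                                (x :+ y) :* (z :+ w)) refl x (- y) z (- w) ⟩
      (x - y) * (z - w)
        ≈⟨ *-cong (⟦⟧-difference a b) (⟦⟧-difference c d) ⟨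
      ⟦ a , b ⟧ * ⟦ c , d ⟧ ∎
      where
      x = a · 1#
      y = b · 1#
      z = c · 1#
      w = d · 1#

    -‿homo : ∀ p → ⟦ ⊝ p ⟧ ≈ - ⟦ p ⟧
    -‿homo (a , b) = begin
      ⟦ b , a ⟧            ≈⟨ ⟦⟧-difference b a ⟩
      b · 1# - a · 1#      ≈⟨ ⁻¹-anti-homo‿- _ _ ⟨
      - (a · 1# - b · 1#)  ≈⟨ -‿cong (⟦⟧-difference a b) ⟨
      - ⟦ a , b ⟧          ∎

    homomorphism : ℤ-ring -Raw-AlmostCommutative⟶ almost
    homomorphism = record
      { ⟦_⟧    = ⟦_⟧
      ; +-homo = +-homo
      ; *-homo = *-homo
      ; -‿homo = -‿homo
      ; 0-homo = refl
      ; 1-homo = refl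
      }

    _≟_ : WeaklyDecidable (Induced-equivalence homomorphism)
    (a , b) ≟ (c , d) with a ℕ.+ d ℕ.≟ c ℕ.+ b
    ... | yes eq = just (⟦⟧-cong a b c d eq)
    ... | no  _  = nothing

  open RingSolver ℤ-ring almost homomorphism _≟_ public

-- Order arithmetic in an ordered field.

module OrderedField (ℝ : RealNumbers) where
  open RealNumbers ℝ
  open IsDecTotalOrder isDecTotalOrder public
    using (_≟_; ≤-respˡ-≈; ≤-respʳ-≈)
    renaming (refl to ≤-refl; trans to ≤-trans; reflexive to ≤-reflexive;
              antisym to ≤-antisym; total to ≤-total)
  open IntegerCoefficients commutativeRing public
    using (Polynomial; solve; _:=_; _:+_; _:*_; _:-_; :-_; con)
  open Max (DecTotalOrder.totalOrder decTotalOrder) public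
    using (x≤x⊔y; x≤y⊔x)
  open Min (DecTotalOrder.totalOrder decTotalOrder) public
    using (x⊓y≤x; x⊓y≤y)

  :0 : ∀ {n} → Polynomial n
  :0 = con (0 , 0)

  :1 : ∀ {n} → Polynomial n
  :1 = con (1 , 0)

  <-≤-trans : ∀ {x y z} → x < y → y ≤ z → x < z
  <-≤-trans = ToStrict.<-≤-trans _≈_ _≤_ sym ≤-trans ≤-antisym ≤-respʳ-≈

  ≤-<-trans : ∀ {x y z} → x ≤ y → y < z → x < z
  ≤-<-trans = ToStrict.≤-<-trans _≈_ _≤_ ≤-trans ≤-antisym ≤-respˡ-≈

  -- In ≤-shift, ≈-shift and <-shift the second hypothesis says b - a ≈ r - l.
  ≤-shift : ∀ {l r a b} → l ≤ r → a + r ≈ b + l → a ≤ b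
  ≤-shift {l} {r} {a} {b} l≤r eq =
    ≤-respˡ-≈ (solve 2 (λ l a → l :+ (a :- l) := a) refl l a)
      (≤-respʳ-≈ r+[a-l]≈b (+-monoˡ-≤ (a - l) l≤r))
    where
    r+[a-l]≈b : r + (a - l) ≈ b
    r+[a-l]≈b = trans (solve 3 (λ r a l → r :+ (a :- l) := (a :+ r) :- l) refl r a l)
      (trans (+-congʳ eq) (solve 2 (λ b l → (b :+ l) :- l := b) refl b l))

  ≈-shift : ∀ {l r a b} → l ≈ r → a + r ≈ b + l → a ≈ b
  ≈-shift l≈r eq = ≤-antisym (≤-shift (≤-reflexive l≈r) eq)
                             (≤-shift (≤-reflexive (sym l≈r)) (sym eq))

  <-shift : ∀ {l r a b} → l < r → a + r ≈ b + l → a < b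
  <-shift (l≤r , l≉r) eq =
    ≤-shift l≤r eq , λ a≈b → l≉r (≈-shift a≈b (trans (+-comm _ _) (trans (sym eq) (+-comm _ _))))

  +-mono-≤ : ∀ {a b c d} → a ≤ b → c ≤ d → a + c ≤ b + d
  +-mono-≤ {a} {b} {c} {d} a≤b c≤d = ≤-trans (+-monoˡ-≤ c a≤b)
    (≤-shift c≤d (solve 3 (λ b c d → (b :+ c) :+ d := (b :+ d) :+ c) refl b c d))

  0≤x+y : ∀ {x y} → 0# ≤ x → 0# ≤ y → 0# ≤ x + y
  0≤x+y 0≤x 0≤y = ≤-respˡ-≈ (+-identityˡ 0#) (+-mono-≤ 0≤x 0≤y)

  x≤y⇒0≤y-x : ∀ {x y} → x ≤ y → 0# ≤ y - x
  x≤y⇒0≤y-x {x} {y} x≤y = ≤-shift x≤y (solve 2 (λ x y → :0 :+ y := (y :- x) :+ x) refl x y)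

  *-monoˡ-≤ : ∀ {a b} c → 0# ≤ c → a ≤ b → c * a ≤ c * b
  *-monoˡ-≤ {a} {b} c 0≤c a≤b = ≤-shift (*-nonNeg 0≤c (x≤y⇒0≤y-x a≤b))
    (solve 3 (λ a b c → c :* a :+ c :* (b :- a) := c :* b :+ :0) refl a b c)

  0≤x*x : ∀ x → 0# ≤ x * x
  0≤x*x x with ≤-total 0# x
  ... | inj₁ 0≤x = *-nonNeg 0≤x 0≤x
  ... | inj₂ x≤0 = ≤-respʳ-≈ (solve 1 (λ x → (:0 :- x) :* (:0 :- x) := x :* x) refl x)
                             (*-nonNeg (x≤y⇒0≤y-x x≤0) (x≤y⇒0≤y-x x≤0))

  *-cancelˡ-≈0 : ∀ {x y} → ¬ (x ≈ 0#) → x * y ≈ 0# → y ≈ 0#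
  *-cancelˡ-≈0 {x} {y} x≉0 xy≈0 = trans (sym (*-identityˡ y))
    (trans (*-congʳ (sym (⁻¹-inverseʳ x≉0)))
    (trans (solve 3 (λ x y z → (x :* z) :* y := z :* (x :* y)) refl x y (x ⁻¹))
    (trans (*-congˡ xy≈0) (zeroʳ (x ⁻¹)))))

  0<x⇒x≉0 : ∀ {x} → 0# < x → ¬ (x ≈ 0#)
  0<x⇒x≉0 0<x x≈0 = proj₂ 0<x (sym x≈0)

  *-cancelˡ-≈ : ∀ {a b c} → 0# < c → c * a ≈ c * b → a ≈ b
  *-cancelˡ-≈ {a} {b} {c} 0<c eq =
    ≈-shift (*-cancelˡ-≈0 (0<x⇒x≉0 0<c) c[a-b]≈0)
      (solve 2 (λ a b → a :+ :0 := b :+ (a :- b)) refl a b)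
    where
    c[a-b]≈0 : c * (a - b) ≈ 0#
    c[a-b]≈0 = ≈-shift eq
      (solve 3 (λ a b c → c :* (a :- b) :+ c :* b := :0 :+ c :* a) refl a b c)

  -- The sign of `c ⁻¹` is avoided by totality: if `b ≤ a`, monotonicity and the hypothesis force
  -- `c * a ≈ c * b`, hence `a ≈ b`.
  *-cancelˡ-≤ : ∀ {a b c} → 0# < c → c * a ≤ c * b → a ≤ b
  *-cancelˡ-≤ {a} {b} {c} 0<c ca≤cb with ≤-total a b
  ... | inj₁ a≤b = a≤b
  ... | inj₂ b≤a = ≤-reflexive
    (*-cancelˡ-≈ 0<c (≤-antisym ca≤cb (*-monoˡ-≤ c (proj₁ 0<c) b≤a)))

  *-cancelˡ-0≤ : ∀ {c x} → 0# < c → 0# ≤ c * x → 0# ≤ x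
  *-cancelˡ-0≤ 0<c 0≤cx = *-cancelˡ-≤ 0<c (≤-respˡ-≈ (sym (zeroʳ _)) 0≤cx)

  *-cancelˡ-0< : ∀ {c x} → 0# < c → 0# < c * x → 0# < x
  *-cancelˡ-0< {c} 0<c (0≤cx , 0≉cx) = *-cancelˡ-0≤ 0<c 0≤cx ,
    λ 0≈x → 0≉cx (trans (sym (zeroʳ c)) (*-congˡ 0≈x))

  *-monoˡ-< : ∀ {a b c} → 0# < c → a < b → c * a < c * b
  *-monoˡ-< {c = c} 0<c (a≤b , a≉b) =
    *-monoˡ-≤ c (proj₁ 0<c) a≤b , λ eq → a≉b (*-cancelˡ-≈ 0<c eq)

  0<x*y : ∀ {x y} → 0# < x → 0# < y → 0# < x * y
  0<x*y {x} 0<x 0<y = ≤-<-trans (≤-reflexive (sym (zeroʳ x))) (*-monoˡ-< 0<x 0<y)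

  x<x+y : ∀ x {y} → 0# < y → x < x + y
  x<x+y x 0<y = <-shift 0<y (sym (+-identityʳ _))

  0<x+y : ∀ {x y} → 0# < x → 0# < y → 0# < x + y
  0<x+y {x} 0<x 0<y = <-≤-trans 0<x (proj₁ (x<x+y x 0<y))

  0<1 : 0# < 1#
  0<1 = ≤-respʳ-≈ (*-identityˡ 1#) (0≤x*x 1#) , 0≉1

  *-/-cancel : ∀ {c} a → 0# < c → c * (a / c) ≈ a
  *-/-cancel {c} a 0<c = trans
    (solve 3 (λ a c d → c :* (a :* d) := (c :* d) :* a) refl a c (c ⁻¹))
    (trans (*-congʳ (⁻¹-inverseʳ (0<x⇒x≉0 0<c))) (*-identityˡ a))

  x≤a/c⇒c*x≤a : ∀ {x a c} → 0# < c → x ≤ a / c → c * x ≤ a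
  x≤a/c⇒c*x≤a {c = c} 0<c x≤a/c =
    ≤-respʳ-≈ (*-/-cancel _ 0<c) (*-monoˡ-≤ c (proj₁ 0<c) x≤a/c)

  a/c<x⇒a<c*x : ∀ {x a c} → 0# < c → a / c < x → a < c * x
  a/c<x⇒a<c*x 0<c a/c<x =
    ≤-<-trans (≤-reflexive (sym (*-/-cancel _ 0<c))) (*-monoˡ-< 0<c a/c<x)

  -- The midpoint works, because `two * (y - x)` and `two * (z - y)` both equal `z - x`.
  <-dense : ∀ {x z} → x < z → ∃ λ y → x < y × y < z
  <-dense {x} {z} x<z = y , x<y , y<z
    where
    two = 1# + 1#
    0<two = 0<x+y 0<1 0<1
    y = (x + z) / two

    2y≈x+z : two * y ≈ x + z
    2y≈x+z = *-/-cancel (x + z) 0<two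

    x<y : x < y
    x<y = <-shift (*-cancelˡ-0< 0<two (<-shift x<z
      (≈-shift (sym 2y≈x+z) (solve 3 (λ x y z →
         (:0 :+ z) :+ (:1 :+ :1) :* y := ((:1 :+ :1) :* (y :- x) :+ x) :+ (x :+ z)) refl x y z))))
      (solve 2 (λ x y → x :+ (y :- x) := y :+ :0) refl x y)

    y<z : y < z
    y<z = <-shift (*-cancelˡ-0< 0<two (<-shift x<z
      (≈-shift 2y≈x+z (solve 3 (λ x y z →
         (:0 :+ z) :+ (x :+ z) := ((:1 :+ :1) :* (z :- y) :+ x) :+ (:1 :+ :1) :* y) refl x y z))))
      (solve 2 (λ y z → y :+ (z :- y) := z :+ :0) refl y z)

  x⊔y<z⇒x<z×y<z : ∀ {x y z} → x ⊔ y < z → x < z × y < z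
  x⊔y<z⇒x<z×y<z {x} {y} x⊔y<z = ≤-<-trans (x≤x⊔y x y) x⊔y<z , ≤-<-trans (x≤y⊔x x y) x⊔y<z

  x≤y⊓z⇒x≤y×x≤z : ∀ {x y z} → x ≤ y ⊓ z → x ≤ y × x ≤ z
  x≤y⊓z⇒x≤y×x≤z {y = y} {z} x≤y⊓z = ≤-trans x≤y⊓z (x⊓y≤x y z) , ≤-trans x≤y⊓z (x⊓y≤y y z)

-- Inequalities between finite sums.

module FiniteSum (ℝ : RealNumbers) where
  open RealNumbers ℝ
  open OrderedField ℝ
  open Sum semiring using (sum)

  sum-mono-≤ : ∀ {n} {xs ys : Vector Carrier n} → (∀ i → xs i ≤ ys i) → sum xs ≤ sum ys
  sum-mono-≤ {ℕ.zero}  xs≤ys = ≤-refl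
  sum-mono-≤ {ℕ.suc n} xs≤ys = +-mono-≤ (xs≤ys 0F) (sum-mono-≤ (xs≤ys ∘ suc))

  sum-nonNeg : ∀ {n} {xs : Vector Carrier n} → (∀ i → 0# ≤ xs i) → 0# ≤ sum xs
  sum-nonNeg {ℕ.zero}  0≤xs = ≤-refl
  sum-nonNeg {ℕ.suc n} 0≤xs = 0≤x+y (0≤xs 0F) (sum-nonNeg (0≤xs ∘ suc))

  -- Dropping non-negative terms cannot increase a sum, so the head and the sum of the tail are both
  -- at most `0#`.
  sum≤0⇒≈0 : ∀ {n} {xs : Vector Carrier n} → (∀ i → 0# ≤ xs i) → sum xs ≤ 0# → ∀ i → xs i ≈ 0#
  sum≤0⇒≈0 0≤xs Σ≤0 0F = ≤-antisym
    (≤-trans (≤-shift (sum-nonNeg (0≤xs ∘ suc)) (sym (+-identityʳ _))) Σ≤0) (0≤xs 0F)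
  sum≤0⇒≈0 0≤xs Σ≤0 (suc i) = sum≤0⇒≈0 (0≤xs ∘ suc)
    (≤-trans (≤-shift (0≤xs 0F) (trans (+-comm _ _) (sym (+-identityʳ _)))) Σ≤0) i

-- Uniqueness of the equilibrium time by a variational inequality.

module Wardrop (ℝ : RealNumbers) (α β : Link → RealNumbers.Carrier ℝ)
               (0<β : ∀ l → RealNumbers._<_ ℝ (RealNumbers.0# ℝ) (β l)) where
  open RealNumbers ℝ
  open OrderedField ℝ
  open FiniteSum ℝ
  open Sum semiring using (sum; sum-cong-≋; ∑-distrib-+; *-distribˡ-sum)
  open Traffic ℝ α β
  open IsEquilibrium
  open SetoidReasoning setoid

  module _ (G : Network) where

    -- This is ⟨f,g⟩: `g` travels while the times are frozen at those caused by `f`.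
    cost : PathFlow G → PathFlow G → Carrier
    cost f g = sum λ i → pathTime G f i * g i

    linkCost : PathFlow G → PathFlow G → Carrier
    linkCost f g = sum λ l → linkTime G f l * linkFlow G g l

    deviation : PathFlow G → PathFlow G → Link → Carrier
    deviation f g l = linkFlow G f l - linkFlow G g l

    weightedDeviation : PathFlow G → PathFlow G → Vector Carrier 5
    weightedDeviation f g l = β l * (deviation f g l * deviation f g l)

    -- On each link the time is affine in the flow with slope `β l`, so the time difference
    -- multiplied by the flow difference is `β l` times a square.
    linkCost-monotone : ∀ f g → linkCost f f + linkCost g g ≈
      (linkCost f g + linkCost g f) + sum (weightedDeviation f g)
    linkCost-monotone f g = begin
      sum (c f f) + sum (c g g)                                  ≈⟨ ∑-distrib-+ (c f f) (c g g) ⟨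
      sum (λ l → c f f l + c g g l)                              ≈⟨ sum-cong-≋ expand ⟩
      sum (λ l → (c f g l + c g f l) + weightedDeviation f g l)
        ≈⟨ ∑-distrib-+ (λ l → c f g l + c g f l) (weightedDeviation f g) ⟩
      sum (λ l → c f g l + c g f l) + sum (weightedDeviation f g)
        ≈⟨ +-congʳ (∑-distrib-+ (c f g) (c g f)) ⟩
      (sum (c f g) + sum (c g f)) + sum (weightedDeviation f g)  ∎
      where
      c : PathFlow G → PathFlow G → Vector Carrier 5
      c f g l = linkTime G f l * linkFlow G g l

      expand : ∀ l → c f f l + c g g l ≈ (c f g l + c g f l) + weightedDeviation f g l
      expand l = solve 4 (λ a b x y →
        (a :+ b :* x) :* x :+ (a :+ b :* y) :* y :=
        ((a :+ b :* x) :* y :+ (a :+ b :* y) :* x) :+ b :* ((x :- y) :* (x :- y)))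
        refl (α l) (β l) (linkFlow G f l) (linkFlow G g l)

    module _ {Q T : Carrier} {f : PathFlow G} (eq : IsEquilibrium G Q f T) where

      T≤pathTime : ∀ i → T ≤ pathTime G f i
      T≤pathTime i with f i ≟ 0#
      ... | yes fi≈0 = vanishing eq i fi≈0
      ... | no  fi≉0 = ≤-reflexive (sym (nonVanishing eq i fi≉0))

      T*Q≈sum : ∀ {g} → IsFlow G Q g → T * Q ≈ sum (λ i → T * g i)
      T*Q≈sum {g} (_ , Σg≈Q) = trans (*-congˡ (sym Σg≈Q)) (*-distribˡ-sum T g)

      -- The variational inequality: at the times of `f` no path is faster than `T`, so every unit
      -- of `g` costs at least `T`.
      T*Q≤cost : ∀ {g} → IsFlow G Q g → T * Q ≤ cost f g
      T*Q≤cost {g} g-flow@(0≤g , _) = ≤-respˡ-≈ (sym (T*Q≈sum g-flow)) (sum-mono-≤ λ i →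
        ≤-respˡ-≈ (*-comm _ _) (≤-respʳ-≈ (*-comm _ _) (*-monoˡ-≤ (g i) (0≤g i) (T≤pathTime i))))

      -- The variational inequality is tight at `f` itself: only paths of time `T` contribute.
      T*Q≈cost : T * Q ≈ cost f f
      T*Q≈cost = trans (T*Q≈sum (isFlow eq)) (sum-cong-≋ term)
        where
        term : ∀ i → T * f i ≈ pathTime G f i * f i
        term i with f i ≟ 0#
        ... | yes fi≈0 = trans (*-congˡ fi≈0) (trans (zeroʳ _) (sym (trans (*-congˡ fi≈0) (zeroʳ _))))
        ... | no  fi≉0 = *-congʳ (sym (nonVanishing eq i fi≉0))

    -- The hypothesis is double counting over pairs of a path and a link on it. It is an assumption
    -- here because it is verified by computation for each concrete network.
    module Uniqueness (cost≈linkCost : ∀ f g → cost f g ≈ linkCost f g) where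

      linkFlow-unique : ∀ {Q T T′ f g} → IsEquilibrium G Q f T → IsEquilibrium G Q g T′ →
                        ∀ l → linkFlow G f l ≈ linkFlow G g l
      linkFlow-unique {Q} {T} {T′} {f} {g} eqf eqg l =
        ≈-shift dev≈0 (solve 2 (λ x y → x :+ :0 := y :+ (x :- y)) refl _ _)
        where
        crossed : linkCost f f + linkCost g g ≤ linkCost f g + linkCost g f
        crossed = ≤-respˡ-≈ (+-cong (trans (T*Q≈cost eqf) (cost≈linkCost f f))
                                    (trans (T*Q≈cost eqg) (cost≈linkCost g g)))
                 (≤-respʳ-≈ (+-cong (cost≈linkCost f g) (cost≈linkCost g f))
                 (+-mono-≤ (T*Q≤cost eqf (isFlow eqg)) (T*Q≤cost eqg (isFlow eqf))))

        sum≤0 : sum (weightedDeviation f g) ≤ 0#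
        sum≤0 = ≤-shift crossed (trans (+-comm _ _)
          (trans (sym (linkCost-monotone f g)) (sym (+-identityˡ _))))

        terms≈0 : ∀ l → weightedDeviation f g l ≈ 0#
        terms≈0 = sum≤0⇒≈0 (λ l → *-nonNeg (proj₁ (0<β l)) (0≤x*x _)) sum≤0

        dev≈0 : deviation f g l ≈ 0#
        dev≈0 with deviation f g l ≟ 0#
        ... | yes d≈0 = d≈0
        -- From `β l` times the square of the deviation being zero, cancel `β l` and then one factor
        -- of the square.
        ... | no  d≉0 = *-cancelˡ-≈0 d≉0 (*-cancelˡ-≈0 (0<x⇒x≉0 (0<β l)) (terms≈0 l))

      -- Equal link flows give equal link times, so `g` costs the same at the times of `f` as at its
      -- own; the variational inequality then compares `T * Q` with `T′ * Q`.
      time-≤ : ∀ {Q T T′ f g} → 0# < Q → IsEquilibrium G Q f T → IsEquilibrium G Q g T′ → T ≤ T′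
      time-≤ {Q} {T} {T′} {f} {g} 0<Q eqf eqg = *-cancelˡ-≤ 0<Q
        (≤-respˡ-≈ (*-comm T Q) (≤-respʳ-≈ cost≈ (T*Q≤cost eqf (isFlow eqg))))
        where
        cost≈ : cost f g ≈ Q * T′
        cost≈ = begin
          cost f g      ≈⟨ cost≈linkCost f g ⟩
          linkCost f g  ≈⟨ sum-cong-≋ (λ l →
            *-congʳ {linkFlow G g l} (+-congˡ {α l} (*-congˡ {β l} (linkFlow-unique eqf eqg l)))) ⟩
          linkCost g g  ≈⟨ cost≈linkCost g g ⟨
          cost g g      ≈⟨ T*Q≈cost eqg ⟨
          T′ * Q        ≈⟨ *-comm T′ Q ⟩
          Q * T′        ∎

      isEquilibriumTime : ∀ {Q f T} → 0# < Q → IsEquilibrium G Q f T → IsEquilibriumTime G Q T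
      isEquilibriumTime {f = f} 0<Q eq = record
        { attained = f , eq
        ; unique   = λ _ _ eq′ → ≤-antisym (time-≤ 0<Q eq′ eq) (time-≤ 0<Q eq eq′)
        }

    -- A path of time exactly `T` meets both clauses of equilibrium whatever its flow, so there is
    -- no need to decide whether a computed flow happens to be zero.
    isEquilibrium : ∀ {Q f T} → IsFlow G Q f →
      (∀ i → (f i ≈ 0# × T ≤ pathTime G f i) ⊎ pathTime G f i ≈ T) → IsEquilibrium G Q f T
    isEquilibrium flow condition = record
      { isFlow       = flow
      ; nonVanishing = λ i fi≉0 → nonVanishing′ (condition i) fi≉0
      ; vanishing    = λ i _ → vanishing′ (condition i)
      }
      where
      nonVanishing′ : ∀ {x t T} → (x ≈ 0# × T ≤ t) ⊎ t ≈ T → ¬ (x ≈ 0#) → t ≈ T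
      nonVanishing′ (inj₁ (x≈0 , _)) x≉0 = contradiction x≈0 x≉0
      nonVanishing′ (inj₂ t≈T)       _   = t≈T

      vanishing′ : ∀ {x t T} → (x ≈ 0# × T ≤ t) ⊎ t ≈ T → T ≤ t
      vanishing′ (inj₁ (_ , T≤t)) = T≤t
      vanishing′ (inj₂ t≈T)       = ≤-reflexive (sym t≈T)

  -- Link times stay opaque variables. The zeros are the contributions of paths avoiding a link and
  -- the ends of the unfolded sums.
  cost≈linkCost-N : ∀ f g → cost N f g ≈ linkCost N f g
  cost≈linkCost-N f g = solve 7 (λ c₁ c₂ c₃ c₄ c₅ x y →
    (c₁ :+ (c₂ :+ :0)) :* x :+ ((c₄ :+ (c₅ :+ :0)) :* y :+ :0) :=
    c₁ :* (x :+ (:0 :+ :0)) :+ (c₂ :* (x :+ (:0 :+ :0)) :+ (c₃ :* (:0 :+ (:0 :+ :0)) :+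
    (c₄ :* (:0 :+ (y :+ :0)) :+ (c₅ :* (:0 :+ (y :+ :0)) :+ :0))))) refl
    (linkTime N f ab) (linkTime N f bd) (linkTime N f bc) (linkTime N f ac) (linkTime N f cd) (g 0F) (g 1F)

  cost≈linkCost-N⁺ : ∀ f g → cost N⁺ f g ≈ linkCost N⁺ f g
  cost≈linkCost-N⁺ f g = solve 8 (λ c₁ c₂ c₃ c₄ c₅ x y z →
    (c₁ :+ (c₂ :+ :0)) :* x :+ ((c₄ :+ (c₅ :+ :0)) :* y :+ ((c₁ :+ (c₃ :+ (c₅ :+ :0))) :* z :+ :0)) :=
    c₁ :* (x :+ (:0 :+ (z :+ :0))) :+ (c₂ :* (x :+ (:0 :+ (:0 :+ :0))) :+ (c₃ :* (:0 :+ (:0 :+ (z :+ :0))) :+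
    (c₄ :* (:0 :+ (y :+ (:0 :+ :0))) :+ (c₅ :* (:0 :+ (y :+ (z :+ :0))) :+ :0))))) refl
    (linkTime N⁺ f ab) (linkTime N⁺ f bd) (linkTime N⁺ f bc) (linkTime N⁺ f ac) (linkTime N⁺ f cd)
    (g 0F) (g 1F) (g 2F)

-- Explicit equilibria of both networks.

module Equilibria (ℝ : RealNumbers) (α β : Link → RealNumbers.Carrier ℝ)
                  (0<β : ∀ l → RealNumbers._<_ ℝ (RealNumbers.0# ℝ) (β l)) where
  open RealNumbers ℝ
  open OrderedField ℝ
  open Traffic ℝ α β
  open Wardrop ℝ α β 0<β

  -- Travel times on P₁, P₂, P₃ under the path flows x, y, z.
  t₁ t₂ : Carrier → Carrier → Carrier
  t₁ x z = (α₁ + α₂) + (β₁₂ * x + β₁ * z)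
  t₂ y z = (α₄ + α₅) + (β₄₅ * y + β₅ * z)

  t₃ : Carrier → Carrier → Carrier → Carrier
  t₃ x y z = (α₁ + α₃ + α₅) + (β₁ * x + β₅ * y + (β₁ + β₃ + β₅) * z)

  -- Where an identity does not involve all ten parameters, the others are instantiated
  -- with arbitrary ones to keep the number of solver variables down.
  module Syntax {n} (a₁ a₂ a₃ a₄ a₅ b₁ b₂ b₃ b₄ b₅ : Polynomial n) where
    :t₁ :t₂ : Polynomial n → Polynomial n → Polynomial n
    :t₁ x z = (a₁ :+ a₂) :+ ((b₁ :+ b₂) :* x :+ b₁ :* z)
    :t₂ y z = (a₄ :+ a₅) :+ ((b₄ :+ b₅) :* y :+ b₅ :* z)

    :t₃ : Polynomial n → Polynomial n → Polynomial n → Polynomial n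
    :t₃ x y z = (a₁ :+ a₃ :+ a₅) :+ (b₁ :* x :+ b₅ :* y :+ (b₁ :+ b₃ :+ b₅) :* z)

    :α₀ :ᾱ :α̂ :𝓑₁ :β₁₂ :β₁₄ :β₂₅ :β₄₅ : Polynomial n
    :α₀  = (a₄ :+ a₅) :- (a₁ :+ a₂)
    :ᾱ   = a₄ :- (a₁ :+ a₃)
    :α̂   = a₂ :- (a₃ :+ a₅)
    :𝓑₁  = b₁ :* b₅ :- b₂ :* b₄
    :β₁₂ = b₁ :+ b₂
    :β₁₄ = b₁ :+ b₄
    :β₂₅ = b₂ :+ b₅
    :β₄₅ = b₄ :+ b₅

    :Δ : Polynomial n
    :Δ = :β₁₄ :* :β₂₅ :+ b₃ :* (:β₁₂ :+ :β₄₅)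

    :n₁ :n₂ :n₃ : Polynomial n → Polynomial n
    :n₁ q = (b₃ :* :β₄₅ :+ b₅ :* :β₁₄) :* q :- (:α̂ :* :β₁₄ :- :α₀ :* b₃)
    :n₂ q = (b₁ :* :β₂₅ :+ b₃ :* :β₁₂) :* q :- (:ᾱ :* :β₂₅ :+ :α₀ :* b₃)
    :n₃ q = (:α̂ :* :β₁₄ :+ :ᾱ :* :β₂₅) :- q :* :𝓑₁

  UsedOrSlow : Carrier → Carrier → Carrier → Set
  UsedOrSlow T x t = (x ≈ 0# × T ≤ t) ⊎ t ≈ T

  UsedOrSlow-resp : ∀ {T x t t′} → t ≈ t′ → UsedOrSlow T x t → UsedOrSlow T x t′
  UsedOrSlow-resp t≈t′ (inj₁ (x≈0 , T≤t)) = inj₁ (x≈0 , ≤-respʳ-≈ t≈t′ T≤t)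
  UsedOrSlow-resp t≈t′ (inj₂ t≈T)         = inj₂ (trans (sym t≈t′) t≈T)

  N-equilibrium : ∀ {q T} x y → 0# ≤ x → 0# ≤ y → x + y ≈ q →
    UsedOrSlow T x (t₁ x 0#) → UsedOrSlow T y (t₂ y 0#) →
    IsEquilibrium N q (x ∷ y ∷ []) T
  N-equilibrium x y 0≤x 0≤y x+y≈q u₁ u₂ = isEquilibrium N
    ((λ { 0F → 0≤x ; 1F → 0≤y }) , trans (+-congˡ (+-identityʳ y)) x+y≈q)
    λ { 0F → UsedOrSlow-resp (solve 5 (λ a₁ a₂ b₁ b₂ x →
               (a₁ :+ a₂) :+ ((b₁ :+ b₂) :* x :+ b₁ :* :0) :=
               (a₁ :+ b₁ :* (x :+ (:0 :+ :0))) :+ ((a₂ :+ b₂ :* (x :+ (:0 :+ :0))) :+ :0))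
               refl α₁ α₂ β₁ β₂ x) u₁
      ; 1F → UsedOrSlow-resp (solve 5 (λ a₄ a₅ b₄ b₅ y →
               (a₄ :+ a₅) :+ ((b₄ :+ b₅) :* y :+ b₅ :* :0) :=
               (a₄ :+ b₄ :* (:0 :+ (y :+ :0))) :+ ((a₅ :+ b₅ :* (:0 :+ (y :+ :0))) :+ :0))
               refl α₄ α₅ β₄ β₅ y) u₂
      }

  N⁺-equilibrium : ∀ {q T} x y z → 0# ≤ x → 0# ≤ y → 0# ≤ z → x + y + z ≈ q →
    UsedOrSlow T x (t₁ x z) → UsedOrSlow T y (t₂ y z) → UsedOrSlow T z (t₃ x y z) →
    IsEquilibrium N⁺ q (x ∷ y ∷ z ∷ []) T
  N⁺-equilibrium x y z 0≤x 0≤y 0≤z Σ≈q u₁ u₂ u₃ = isEquilibrium N⁺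
    ( (λ { 0F → 0≤x ; 1F → 0≤y ; 2F → 0≤z })
    , trans (solve 3 (λ x y z → x :+ (y :+ (z :+ :0)) := x :+ y :+ z) refl x y z) Σ≈q)
    λ { 0F → UsedOrSlow-resp (solve 6 (λ a₁ a₂ b₁ b₂ x z →
               (a₁ :+ a₂) :+ ((b₁ :+ b₂) :* x :+ b₁ :* z) :=
               (a₁ :+ b₁ :* (x :+ (:0 :+ (z :+ :0)))) :+ ((a₂ :+ b₂ :* (x :+ (:0 :+ (:0 :+ :0)))) :+ :0))
               refl α₁ α₂ β₁ β₂ x z) u₁
      ; 1F → UsedOrSlow-resp (solve 6 (λ a₄ a₅ b₄ b₅ y z →
               (a₄ :+ a₅) :+ ((b₄ :+ b₅) :* y :+ b₅ :* z) :=
               (a₄ :+ b₄ :* (:0 :+ (y :+ (:0 :+ :0)))) :+ ((a₅ :+ b₅ :* (:0 :+ (y :+ (z :+ :0)))) :+ :0))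
               refl α₄ α₅ β₄ β₅ y z) u₂
      ; 2F → UsedOrSlow-resp (solve 9 (λ a₁ a₃ a₅ b₁ b₃ b₅ x y z →
               (a₁ :+ a₃ :+ a₅) :+ (b₁ :* x :+ b₅ :* y :+ (b₁ :+ b₃ :+ b₅) :* z) :=
               (a₁ :+ b₁ :* (x :+ (:0 :+ (z :+ :0)))) :+
               ((a₃ :+ b₃ :* (:0 :+ (:0 :+ (z :+ :0)))) :+
               ((a₅ :+ b₅ :* (:0 :+ (y :+ (z :+ :0)))) :+ :0)))
               refl α₁ α₃ α₅ β₁ β₃ β₅ x y z) u₃
      }

  sameEquilibriumTime : ∀ {q T T⁺ f f⁺} → 0# < q →
    IsEquilibrium N q f T → IsEquilibrium N⁺ q f⁺ T⁺ → T⁺ ≈ T → SameEquilibriumTime q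
  sameEquilibriumTime {T = T} {T⁺} 0<q eq eq⁺ T⁺≈T =
    T , T⁺ ,
    Uniqueness.isEquilibriumTime N cost≈linkCost-N 0<q eq ,
    Uniqueness.isEquilibriumTime N⁺ cost≈linkCost-N⁺ 0<q eq⁺ ,
    T⁺≈T

  -- With zero flow on P₃, the paths P₁ and P₂ have the same times in both networks, so `u₁` and
  -- `u₂` serve twice and only P₃ needs a new inequality.
  unusedBridge : ∀ {q T} x y → 0# < q → 0# ≤ x → 0# ≤ y → x + y ≈ q →
    UsedOrSlow T x (t₁ x 0#) → UsedOrSlow T y (t₂ y 0#) → T ≤ t₃ x y 0# →
    SameEquilibriumTime q
  unusedBridge x y 0<q 0≤x 0≤y x+y≈q u₁ u₂ T≤t₃ = sameEquilibriumTime 0<q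
    (N-equilibrium x y 0≤x 0≤y x+y≈q u₁ u₂)
    (N⁺-equilibrium x y 0# 0≤x 0≤y ≤-refl (trans (+-identityʳ _) x+y≈q) u₁ u₂ (inj₁ (refl , T≤t₃)))
    refl

  0<β₁₂ : 0# < β₁₂
  0<β₁₂ = 0<x+y (0<β ab) (0<β bd)

  0<β₁₄ : 0# < β₁₄
  0<β₁₄ = 0<x+y (0<β ab) (0<β ac)

  0<β₂₅ : 0# < β₂₅
  0<β₂₅ = 0<x+y (0<β bd) (0<β cd)

  0<β₄₅ : 0# < β₄₅
  0<β₄₅ = 0<x+y (0<β ac) (0<β cd)

  -- The first inequality compares P₂ carrying everything with the empty P₁. The second compares it
  -- with P₃: the shared link `cd` cancels, leaving `ac` against `ab` and `bc`.
  onlyP₂ : ∀ {q} → 0# < q → β₄₅ * q ≤ - α₀ → β₄ * q ≤ - ᾱ → SameEquilibriumTime q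
  onlyP₂ {q} 0<q β₄₅q≤-α₀ β₄q≤-ᾱ =
    unusedBridge 0# q 0<q ≤-refl (proj₁ 0<q) (+-identityˡ q)
      (inj₁ (refl , ≤-shift β₄₅q≤-α₀
        (solve 9 (λ a₁ a₂ a₄ a₅ b₁ b₂ b₄ b₅ q →
          let open Syntax a₁ a₂ a₂ a₄ a₅ b₁ b₂ b₂ b₄ b₅ in
          :t₂ q :0 :+ :- :α₀ := :t₁ :0 :0 :+ (b₄ :+ b₅) :* q)
          refl α₁ α₂ α₄ α₅ β₁ β₂ β₄ β₅ q)))
      (inj₂ refl)
      (≤-shift β₄q≤-ᾱ
        (solve 9 (λ a₁ a₃ a₄ a₅ b₁ b₃ b₄ b₅ q →
          let open Syntax a₁ a₁ a₃ a₄ a₅ b₁ b₁ b₃ b₄ b₅ in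
          :t₂ q :0 :+ :- :ᾱ := :t₃ :0 q :0 :+ b₄ :* q)
          refl α₁ α₃ α₄ α₅ β₁ β₃ β₄ β₅ q))

  -- Against P₃ the shared link `ab` cancels, leaving `bd` against `bc` and `cd`.
  onlyP₁ : ∀ {q} → 0# < q → β₁₂ * q ≤ α₀ → β₂ * q ≤ - α̂ → SameEquilibriumTime q
  onlyP₁ {q} 0<q β₁₂q≤α₀ β₂q≤-α̂ =
    unusedBridge q 0# 0<q (proj₁ 0<q) ≤-refl (+-identityʳ q)
      (inj₂ refl)
      (inj₁ (refl , ≤-shift β₁₂q≤α₀
        (solve 9 (λ a₁ a₂ a₄ a₅ b₁ b₂ b₄ b₅ q →
          let open Syntax a₁ a₂ a₂ a₄ a₅ b₁ b₂ b₂ b₄ b₅ in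
          :t₁ q :0 :+ :α₀ := :t₂ :0 :0 :+ (b₁ :+ b₂) :* q)
          refl α₁ α₂ α₄ α₅ β₁ β₂ β₄ β₅ q)))
      (≤-shift β₂q≤-α̂
        (solve 9 (λ a₁ a₂ a₃ a₅ b₁ b₂ b₃ b₅ q →
          let open Syntax a₁ a₂ a₃ a₁ a₅ b₁ b₂ b₃ b₁ b₅ in
          :t₁ q :0 :+ :- :α̂ := :t₃ q :0 :0 :+ b₂ :* q)
          refl α₁ α₂ α₃ α₅ β₁ β₂ β₃ β₅ q))

  -- The flow x below is the solution of t₁ x 0 = t₂ (q - x) 0.
  module BothPaths {q} (0<q : 0# < q) (α₀<β₁₂q : α₀ < β₁₂ * q) (-α₀<β₄₅q : - α₀ < β₄₅ * q) where

    B x y T : Carrier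
    B = β₁₂ + β₄₅
    x = (β₄₅ * q + α₀) / B
    y = q - x
    T = t₁ x 0#

    0<B : 0# < B
    0<B = 0<x+y 0<β₁₂ 0<β₄₅

    Bx≈ : B * x ≈ β₄₅ * q + α₀
    Bx≈ = *-/-cancel _ 0<B

    0≤x : 0# ≤ x
    0≤x = *-cancelˡ-0≤ 0<B (≤-respʳ-≈ (sym Bx≈) (≤-shift (proj₁ -α₀<β₄₅q)
      (solve 2 (λ a b → :0 :+ b := (b :+ a) :+ :- a) refl α₀ (β₄₅ * q))))

    0≤y : 0# ≤ y
    0≤y = *-cancelˡ-0≤ 0<B (≤-respʳ-≈ (sym By≈) (x≤y⇒0≤y-x (proj₁ α₀<β₁₂q)))
      where
      By≈ : B * y ≈ β₁₂ * q - α₀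
      By≈ = ≈-shift (sym Bx≈)
        (solve 5 (λ b c q x a → (b :+ c) :* (q :- x) :+ (b :+ c) :* x :=
           (b :* q :- a) :+ (c :* q :+ a)) refl β₁₂ β₄₅ q x α₀)

    x+y≈q : x + y ≈ q
    x+y≈q = solve 2 (λ x q → x :+ (q :- x) := q) refl x q

    t₂≈T : t₂ y 0# ≈ T
    t₂≈T = ≈-shift (sym Bx≈)
      (solve 10 (λ a₁ a₂ a₄ a₅ b₁ b₂ b₄ b₅ q x →
        let open Syntax a₁ a₂ a₂ a₄ a₅ b₁ b₂ b₂ b₄ b₅ in
        :t₂ (q :- x) :0 :+ (:β₁₂ :+ :β₄₅) :* x := :t₁ x :0 :+ (:β₄₅ :* q :+ :α₀))
        refl α₁ α₂ α₄ α₅ β₁ β₂ β₄ β₅ q x)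

    equilibrium : IsEquilibrium N q (x ∷ y ∷ []) T
    equilibrium = N-equilibrium x y 0≤x 0≤y x+y≈q (inj₂ refl) (inj₂ t₂≈T)

    -- By `excess`, the hypothesis says exactly that P₃ is not faster than the common time `T`, up
    -- to the positive factor `B`.
    slowBridge : α̂ * β₁₄ + ᾱ * β₂₅ ≤ q * 𝓑₁ → SameEquilibriumTime q
    slowBridge D≤q𝓑₁ = unusedBridge x y 0<q 0≤x 0≤y x+y≈q (inj₂ refl) (inj₂ t₂≈T)
      (≤-shift (*-cancelˡ-0≤ 0<B (≤-respʳ-≈ (sym excess) (x≤y⇒0≤y-x D≤q𝓑₁)))
        (solve 2 (λ a b → a :+ (b :- a) := b :+ :0) refl T (t₃ x y 0#)))
      where
      excess : B * (t₃ x y 0# - T) ≈ q * 𝓑₁ - (α̂ * β₁₄ + ᾱ * β₂₅)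
      -- In `t₃ x y 0# - T` the flow `x` has coefficient `- β₂₅`, so adding `β₂₅` times the equation
      -- for `B * x` eliminates it.
      excess = ≈-shift (*-congˡ {β₂₅} (sym Bx≈))
        (solve 12 (λ a₁ a₂ a₃ a₄ a₅ b₁ b₂ b₃ b₄ b₅ q x →
          let open Syntax a₁ a₂ a₃ a₄ a₅ b₁ b₂ b₃ b₄ b₅ in
          (:β₁₂ :+ :β₄₅) :* (:t₃ x (q :- x) :0 :- :t₁ x :0) :+ :β₂₅ :* ((:β₁₂ :+ :β₄₅) :* x) :=
          (q :* :𝓑₁ :- (:α̂ :* :β₁₄ :+ :ᾱ :* :β₂₅)) :+ :β₂₅ :* (:β₄₅ :* q :+ :α₀))
          refl α₁ α₂ α₃ α₄ α₅ β₁ β₂ β₃ β₄ β₅ q x)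

    -- The numerators below solve t₁ = t₂ = t₃ for arbitrary 𝓑₁, by Cramer's rule;
    -- the equilibrium times of N and N⁺ then satisfy B (T⁺ - T) = 𝓑₁ f₃.
    module UsedBridge (𝓑₁≈0 : 𝓑₁ ≈ 0#) (0<D : 0# < α̂ * β₁₄ + ᾱ * β₂₅) (μ₁<q : μ₁ < q) (μ₂<q : μ₂ < q) where

      Δ n₁ n₂ n₃ f₁ f₂ f₃ : Carrier
      Δ  = β₁₄ * β₂₅ + β₃ * B
      n₁ = (β₃ * β₄₅ + β₅ * β₁₄) * q - (α̂ * β₁₄ - α₀ * β₃)
      n₂ = (β₁ * β₂₅ + β₃ * β₁₂) * q - (ᾱ * β₂₅ + α₀ * β₃)
      n₃ = (α̂ * β₁₄ + ᾱ * β₂₅) - q * 𝓑₁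
      f₁ = n₁ / Δ
      f₂ = n₂ / Δ
      f₃ = n₃ / Δ

      0<Δ : 0# < Δ
      0<Δ = 0<x+y (0<x*y 0<β₁₄ 0<β₂₅) (0<x*y (0<β bc) 0<B)

      0≤n/Δ : ∀ {n} → 0# ≤ n → 0# ≤ n / Δ
      0≤n/Δ 0≤n = *-cancelˡ-0≤ 0<Δ (≤-respʳ-≈ (sym (*-/-cancel _ 0<Δ)) 0≤n)

      -- `n₁` is the denominator of `μ₁` times `q` minus the numerator of `μ₁`; `n₂` arises from
      -- `μ₂` in the same way.
      0≤f₁ : 0# ≤ f₁
      0≤f₁ = 0≤n/Δ (x≤y⇒0≤y-x (proj₁ (a/c<x⇒a<c*x
        (0<x+y (0<x*y (0<β bc) 0<β₄₅) (0<x*y (0<β cd) 0<β₁₄)) μ₁<q)))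

      0≤f₂ : 0# ≤ f₂
      0≤f₂ = 0≤n/Δ (x≤y⇒0≤y-x (proj₁ (a/c<x⇒a<c*x
        (0<x+y (0<x*y (0<β ab) 0<β₂₅) (0<x*y (0<β bc) 0<β₁₂)) μ₂<q)))

      0≤f₃ : 0# ≤ f₃
      0≤f₃ = 0≤n/Δ (x≤y⇒0≤y-x (≤-respˡ-≈ (sym (trans (*-congˡ 𝓑₁≈0) (zeroʳ q))) (proj₁ 0<D)))

      -- Clears the denominator `Δ` from a travel time, so that equality of times becomes a
      -- polynomial identity in the parameters and `q`.
      Δ[c+d]≈ : ∀ {a c d n m} → Δ * c ≈ n → Δ * d ≈ m → Δ * (a + (c + d)) ≈ Δ * a + (n + m)
      Δ[c+d]≈ Δc≈n Δd≈m = trans (distribˡ Δ _ _) (+-congˡ (trans (distribˡ Δ _ _) (+-cong Δc≈n Δd≈m)))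

      Δ[b*f]≈ : ∀ b n → Δ * (b * (n / Δ)) ≈ b * n
      Δ[b*f]≈ b n = trans (solve 3 (λ d b f → d :* (b :* f) := b :* (d :* f)) refl Δ b (n / Δ))
                          (*-congˡ (*-/-cancel n 0<Δ))

      Δt₁≈ : Δ * t₁ f₁ f₃ ≈ Δ * (α₁ + α₂) + (β₁₂ * n₁ + β₁ * n₃)
      Δt₁≈ = Δ[c+d]≈ (Δ[b*f]≈ β₁₂ n₁) (Δ[b*f]≈ β₁ n₃)

      Δt₂≈ : Δ * t₂ f₂ f₃ ≈ Δ * (α₄ + α₅) + (β₄₅ * n₂ + β₅ * n₃)
      Δt₂≈ = Δ[c+d]≈ (Δ[b*f]≈ β₄₅ n₂) (Δ[b*f]≈ β₅ n₃)

      Δt₃≈ : Δ * t₃ f₁ f₂ f₃ ≈ Δ * (α₁ + α₃ + α₅) + (β₁ * n₁ + β₅ * n₂ + (β₁ + β₃ + β₅) * n₃)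
      Δt₃≈ = Δ[c+d]≈ (trans (distribˡ Δ _ _) (+-cong (Δ[b*f]≈ β₁ n₁) (Δ[b*f]≈ β₅ n₂)))
                     (Δ[b*f]≈ (β₁ + β₃ + β₅) n₃)

      t₂≈t₁ : t₂ f₂ f₃ ≈ t₁ f₁ f₃
      t₂≈t₁ = *-cancelˡ-≈ 0<Δ (trans Δt₂≈ (trans
        (solve 11 (λ a₁ a₂ a₃ a₄ a₅ b₁ b₂ b₃ b₄ b₅ q →
          let open Syntax a₁ a₂ a₃ a₄ a₅ b₁ b₂ b₃ b₄ b₅ in
          :Δ :* (a₄ :+ a₅) :+ (:β₄₅ :* :n₂ q :+ b₅ :* :n₃ q) :=
          :Δ :* (a₁ :+ a₂) :+ (:β₁₂ :* :n₁ q :+ b₁ :* :n₃ q))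
          refl α₁ α₂ α₃ α₄ α₅ β₁ β₂ β₃ β₄ β₅ q)
        (sym Δt₁≈)))

      t₃≈t₁ : t₃ f₁ f₂ f₃ ≈ t₁ f₁ f₃
      t₃≈t₁ = *-cancelˡ-≈ 0<Δ (trans Δt₃≈ (trans
        (solve 11 (λ a₁ a₂ a₃ a₄ a₅ b₁ b₂ b₃ b₄ b₅ q →
          let open Syntax a₁ a₂ a₃ a₄ a₅ b₁ b₂ b₃ b₄ b₅ in
          :Δ :* (a₁ :+ a₃ :+ a₅) :+ (b₁ :* :n₁ q :+ b₅ :* :n₂ q :+ (b₁ :+ b₃ :+ b₅) :* :n₃ q) :=
          :Δ :* (a₁ :+ a₂) :+ (:β₁₂ :* :n₁ q :+ b₁ :* :n₃ q))
          refl α₁ α₂ α₃ α₄ α₅ β₁ β₂ β₃ β₄ β₅ q)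
        (sym Δt₁≈)))

      Σf≈q : f₁ + f₂ + f₃ ≈ q
      Σf≈q = *-cancelˡ-≈ 0<Δ (trans
        (solve 4 (λ d x y z → d :* (x :+ y :+ z) := d :* x :+ d :* y :+ d :* z) refl Δ f₁ f₂ f₃)
        (trans (+-cong (+-cong (*-/-cancel n₁ 0<Δ) (*-/-cancel n₂ 0<Δ)) (*-/-cancel n₃ 0<Δ))
        (solve 11 (λ a₁ a₂ a₃ a₄ a₅ b₁ b₂ b₃ b₄ b₅ q →
          let open Syntax a₁ a₂ a₃ a₄ a₅ b₁ b₂ b₃ b₄ b₅ in
          :n₁ q :+ :n₂ q :+ :n₃ q := :Δ :* q)
          refl α₁ α₂ α₃ α₄ α₅ β₁ β₂ β₃ β₄ β₅ q)))

      t₁≈T : t₁ f₁ f₃ ≈ T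
      -- Weighting `t₁` by `β₄₅` and `t₂` by `β₁₂` makes `f₁` and `f₂` enter only through
      -- `β₁₂ * β₄₅ * (f₁ + f₂)`. Replacing `f₁ + f₂` by `q - f₃` leaves `𝓑₁ * f₃` as the whole
      -- difference from `B * T`.
      t₁≈T = *-cancelˡ-≈ 0<B (≈-shift
        (+-cong (+-cong (+-cong (*-congˡ {β₁₂} (sym t₂≈t₁)) (*-congˡ {β₁₂ * β₄₅} Σf≈q))
                        (*-congˡ {β₁₂} (sym Bx≈))) (*-congˡ {f₃} 𝓑₁≈0))
        (solve 13 (λ a₁ a₂ a₄ a₅ b₁ b₂ b₄ b₅ q x f₁ f₂ f₃ →
          let open Syntax a₁ a₂ a₂ a₄ a₅ b₁ b₂ b₂ b₄ b₅ in
          (:β₁₂ :+ :β₄₅) :* :t₁ f₁ f₃ :+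
          (:β₁₂ :* :t₂ f₂ f₃ :+ :β₁₂ :* :β₄₅ :* q :+ :β₁₂ :* ((:β₁₂ :+ :β₄₅) :* x) :+ f₃ :* :0) :=
          (:β₁₂ :+ :β₄₅) :* :t₁ x :0 :+
          (:β₁₂ :* :t₁ f₁ f₃ :+ :β₁₂ :* :β₄₅ :* (f₁ :+ f₂ :+ f₃) :+ :β₁₂ :* (:β₄₅ :* q :+ :α₀) :+ f₃ :* :𝓑₁))
          refl α₁ α₂ α₄ α₅ β₁ β₂ β₄ β₅ q x f₁ f₂ f₃))

      usedBridge : SameEquilibriumTime q
      usedBridge = sameEquilibriumTime 0<q equilibrium
        (N⁺-equilibrium f₁ f₂ f₃ 0≤f₁ 0≤f₂ 0≤f₃ Σf≈q (inj₂ refl) (inj₂ t₂≈t₁) (inj₂ t₃≈t₁))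
        t₁≈T

-- The four conditions as non-degenerate intervals.

module Paradox (ℝ : RealNumbers) (α β : Link → RealNumbers.Carrier ℝ)
               (0<β : ∀ l → RealNumbers._<_ ℝ (RealNumbers.0# ℝ) (β l)) where
  open RealNumbers ℝ
  open OrderedField ℝ
  open Traffic ℝ α β
  open Equilibria ℝ α β 0<β

  initialInterval : ∀ {m Q} → 0# < Q → Q ≤ m → IsNonDegenerateInterval (λ q → 0# < q × q ≤ m)
  initialInterval {m} {Q} 0<Q Q≤m = record
    { convex        = λ (0<x , _) (_ , z≤m) x≤y y≤z → <-≤-trans 0<x x≤y , ≤-trans y≤z z≤m
    -- `Q` may be the right end `m`, so the other point is taken between `0#` and `Q`.
    ; nonDegenerate =
        let p , 0<p , p<Q = <-dense 0<Q
        in p , Q , (0<p , ≤-trans (proj₁ p<Q) Q≤m) , (0<Q , Q≤m) , p<Q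
    }

  threshold : Carrier
  threshold = (α₀ / β₁₂) ⊔ ((- α₀) / β₄₅)

  α₀<β₁₂q : ∀ {q} → threshold < q → α₀ < β₁₂ * q
  α₀<β₁₂q t<q = a/c<x⇒a<c*x 0<β₁₂ (proj₁ (x⊔y<z⇒x<z×y<z t<q))

  -α₀<β₄₅q : ∀ {q} → threshold < q → - α₀ < β₄₅ * q
  -α₀<β₄₅q t<q = a/c<x⇒a<c*x 0<β₄₅ (proj₂ (x⊔y<z⇒x<z×y<z t<q))

  -- Adding the two threshold inequalities cancels `α₀` and leaves `(β₁₂ + β₄₅) * q` positive. This
  -- gives positivity throughout the interval, not just at the given `Q`.
  threshold<q⇒0<q : ∀ {q} → threshold < q → 0# < q
  threshold<q⇒0<q {q} t<q = *-cancelˡ-0< (0<x+y 0<β₁₂ 0<β₄₅) (<-≤-trans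
    (0<x+y (<-shift (α₀<β₁₂q t<q) (solve 2 (λ a b → :0 :+ b := (b :- a) :+ a) refl α₀ (β₁₂ * q)))
           (<-shift (-α₀<β₄₅q t<q) (solve 2 (λ a b → :0 :+ b := (b :+ a) :+ :- a) refl α₀ (β₄₅ * q))))
    (≤-reflexive (solve 4 (λ a b c q → (b :* q :- a) :+ (c :* q :+ a) := (b :+ c) :* q) refl α₀ β₁₂ β₄₅ q)))

  -- The sign of `k` decides which way `D ≤ q * k` persists. For `0# ≤ k` a second point is
  -- `Q + 1#`; for `k ≤ 0#` one lies below `Q`, where the strict bound `m < Q` leaves room.
  affineInterval : ∀ {m D k Q} → m < Q → D ≤ Q * k →
    IsNonDegenerateInterval (λ q → m < q × D ≤ q * k)
  affineInterval {m} {D} {k} {Q} m<Q D≤Qk = record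
    { convex = convex ; nonDegenerate = nonDegenerate }
    where
    I : Carrier → Set
    I q = m < q × D ≤ q * k

    increasing : ∀ {x y} → 0# ≤ k → x ≤ y → x * k ≤ y * k
    increasing 0≤k x≤y = ≤-respˡ-≈ (*-comm _ _) (≤-respʳ-≈ (*-comm _ _) (*-monoˡ-≤ k 0≤k x≤y))

    decreasing : ∀ {x y} → k ≤ 0# → x ≤ y → y * k ≤ x * k
    decreasing {x} {y} k≤0 x≤y = ≤-shift (*-nonNeg (x≤y⇒0≤y-x k≤0) (x≤y⇒0≤y-x x≤y))
      (solve 3 (λ x y k → y :* k :+ (:0 :- k) :* (y :- x) := x :* k :+ :0) refl x y k)

    convex : ∀ {x y z} → I x → I z → x ≤ y → y ≤ z → I y
    convex (m<x , D≤xk) (_ , D≤zk) x≤y y≤z = <-≤-trans m<x x≤y , D≤yk (≤-total 0# k)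
      where
      D≤yk : 0# ≤ k ⊎ k ≤ 0# → D ≤ _ * k
      D≤yk (inj₁ 0≤k) = ≤-trans D≤xk (increasing 0≤k x≤y)
      D≤yk (inj₂ k≤0) = ≤-trans D≤zk (decreasing k≤0 y≤z)

    nonDegenerate : ∃₂ λ x y → I x × I y × x < y
    nonDegenerate = go (≤-total 0# k)
      where
      go : 0# ≤ k ⊎ k ≤ 0# → ∃₂ λ x y → I x × I y × x < y
      go (inj₁ 0≤k) =
        let Q<Q+1 = x<x+y Q 0<1
        in Q , Q + 1# , (m<Q , D≤Qk) ,
           (<-≤-trans m<Q (proj₁ Q<Q+1) , ≤-trans D≤Qk (increasing 0≤k (proj₁ Q<Q+1))) , Q<Q+1
      go (inj₂ k≤0) =
        let p , m<p , p<Q = <-dense m<Q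
        in p , Q , (m<p , ≤-trans D≤Qk (decreasing k≤0 (proj₁ p<Q))) , (m<Q , D≤Qk) , p<Q

  conditionA : ∀ {Q} → 0# < Q × Q ≤ ((- α₀) / β₄₅) ⊓ ((- ᾱ) / β₄) → PseudoParadoxAt Q
  conditionA (0<Q , Q≤m) = _ , initialInterval 0<Q Q≤m , (0<Q , Q≤m) , λ q (0<q , q≤m) →
    let q≤₁ , q≤₂ = x≤y⊓z⇒x≤y×x≤z q≤m in
    0<q , onlyP₂ 0<q (x≤a/c⇒c*x≤a 0<β₄₅ q≤₁) (x≤a/c⇒c*x≤a (0<β ac) q≤₂)

  conditionB : ∀ {Q} → 0# < Q × Q ≤ (α₀ / β₁₂) ⊓ ((- α̂) / β₂) → PseudoParadoxAt Q
  conditionB (0<Q , Q≤m) = _ , initialInterval 0<Q Q≤m , (0<Q , Q≤m) , λ q (0<q , q≤m) →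
    let q≤₁ , q≤₂ = x≤y⊓z⇒x≤y×x≤z q≤m in
    0<q , onlyP₁ 0<q (x≤a/c⇒c*x≤a 0<β₁₂ q≤₁) (x≤a/c⇒c*x≤a (0<β bd) q≤₂)

  conditionC : ∀ {Q} → threshold < Q × α̂ * β₁₄ + ᾱ * β₂₅ ≤ Q * 𝓑₁ → PseudoParadoxAt Q
  conditionC (t<Q , D≤Q𝓑₁) = _ , affineInterval t<Q D≤Q𝓑₁ , (t<Q , D≤Q𝓑₁) , λ q (t<q , D≤q𝓑₁) →
    threshold<q⇒0<q t<q ,
    BothPaths.slowBridge (threshold<q⇒0<q t<q) (α₀<β₁₂q t<q) (-α₀<β₄₅q t<q) D≤q𝓑₁

  conditionD : ∀ {Q} → 𝓑₁ ≈ 0# × 0# < α̂ * β₁₄ + ᾱ * β₂₅ × threshold ⊔ μ₁ ⊔ μ₂ < Q →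
    PseudoParadoxAt Q
  -- Taking both `D` and `k` to be `0#` makes the affine condition always true, so the interval is
  -- the open half-line above the maximum.
  conditionD {Q} (𝓑₁≈0 , 0<D , m<Q) = _ , affineInterval m<Q 0≤Q*0 , (m<Q , 0≤Q*0) , λ q (m<q , _) →
    let m′<q , μ₂<q = x⊔y<z⇒x<z×y<z m<q
        t<q  , μ₁<q = x⊔y<z⇒x<z×y<z m′<q
    in threshold<q⇒0<q t<q ,
       BothPaths.UsedBridge.usedBridge (threshold<q⇒0<q t<q) (α₀<β₁₂q t<q) (-α₀<β₄₅q t<q)
         𝓑₁≈0 0<D μ₁<q μ₂<q
    where
    0≤Q*0 : 0# ≤ Q * 0#
    0≤Q*0 = ≤-reflexive (sym (zeroʳ Q))

corollary4 : (ℝ : RealNumbers) →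
    let open RealNumbers ℝ in
    (α β : Link → Carrier) →
    (∀ l → 0# ≤ α l) →
    (∀ l → 0# < β l) →
    (Q : Carrier) →
    0# < Q →
    let open Traffic ℝ α β in
    (0# < Q × Q ≤ ((- α₀) / β₄₅) ⊓ ((- ᾱ) / β₄))
    ⊎ (0# < Q × Q ≤ (α₀ / β₁₂) ⊓ ((- α̂) / β₂))
    ⊎ ((α₀ / β₁₂) ⊔ ((- α₀) / β₄₅) < Q × α̂ * β₁₄ + ᾱ * β₂₅ ≤ Q * 𝓑₁)
    ⊎ (𝓑₁ ≈ 0# × 0# < α̂ * β₁₄ + ᾱ * β₂₅ × (α₀ / β₁₂) ⊔ ((- α₀) / β₄₅) ⊔ μ₁ ⊔ μ₂ < Q) →
    PseudoParadoxAt Q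
corollary4 ℝ α β _ 0<β _ _ = λ where
    (inj₁ a)               → conditionA a
    (inj₂ (inj₁ b))        → conditionB b
    (inj₂ (inj₂ (inj₁ c))) → conditionC c
    (inj₂ (inj₂ (inj₂ d))) → conditionD d
  where open Paradox ℝ α β 0<β
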